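{- Let $P=(P_{ij})_{0\le i,j\le d}$ be the eigenmatrix of a distance-regular graph with classical parameters $(d,b,\alpha,\beta)$. Then for $0\le j\le d$, $$P_{dj} = (-1)^j \genfrac{[}{]}{0pt}{}{d}{j}_b\, b^{\binom{j}{2}}.$$
   Context: For a constant $b$ define $\genfrac{[}{]}{0pt}{}{n}{m} = \genfrac{[}{]}{0pt}{}{n}{m}_b$ to be $0$ if $m<0$, $\binom{n}{m}$ if $b=1$, and $\prod_{h=0}^{m-1}\frac{b^{n-h}-1}{b^{m-h}-1}$ otherwise. A graph with classical parameters $(d,b,\alpha,\beta)$ is a distance-regular graph of diameter $d$ with intersection numbers $$b_i = \left(\genfrac{[}{]}{0pt}{}{d}{1} - \genfrac{[}{]}{0pt}{}{i}{1}\right)\left(\beta - \alpha \genfrac{[}{]}{0pt}{}{i}{1}\right),\qquad c_i = \genfrac{[}{]}{0pt}{}{i}{1}\left(1 + \alpha\genfrac{[}{]}{0pt}{}{i-1}{1}\right)\qquad (0\le i\le d).$$ Its valency is $k = b_0 = \beta\genfrac{[}{]}{0pt}{}{d}{1}$, and $a_i = k-b_i-c_i$. It is known that $b$ is an integer different from $0$ and $-1$. The eigenvalues are $\theta_i = \genfrac{[}{]}{0pt}{}{d-i}{1}\left(\beta - \alpha\genfrac{[}{]}{0pt}{}{i}{1}\right) - \genfrac{[}{]}{0pt}{}{i}{1}$ ($0\le i\le d$). The eigenmatrix $P$ is given by $P_{i0}=1$, $P_{i1}=\theta_i$ and $P_{i,j+1} = \left((\theta_i - a_j) P_{ij} - b_{j-1}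 P_{i,j-1}\right)/c_{j+1}$ for $1\le j\le d-1$. -}

module Defs where

open import Level using (0ℓ)
open import Data.Bool.Base using (if_then_else_)
open import Data.Fin.Base using (Fin; toℕ)
open import Data.Integer.Base as ℤ using (ℤ; +_; -[1+_]; -1ℤ)
open import Data.List.Base using (allFin; filter; length)
open import Data.Nat.Base as ℕ using (ℕ; zero; suc)
open import Data.Nat.Combinatorics using (_C_)
import Data.Nat.Properties as ℕ
open import Data.Product.Base using (_×_; ∃₂)
open import Data.Rational.Base as ℚ
  using (ℚ; 0ℚ; 1ℚ; _+_; _-_; _*_; _÷_; ≢-nonZero; +-*-rawSemiring)
open import Data.Rational.Properties using (_≟_)
open import Relation.Binary.Core using (Rel)
open import Relation.Binary.Definitions using (Decidable; Symmetric; Irreflexive)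
open import Relation.Binary.PropositionalEquality.Core using (_≡_)
open import Relation.Nullary.Decidable.Core using (does; yes; no; _×-dec_)

open import Algebra.Definitions.RawSemiring +-*-rawSemiring public
  using (_^_; product)

ℤ→ℚ : ℤ → ℚ
ℤ→ℚ i = i ℚ./ 1

ℕ→ℚ : ℕ → ℚ
ℕ→ℚ n = ℤ→ℚ (+ n)

infixl 7 _÷₀_

-- Division made total by the junk value p ÷₀ 0 = 0.  It lets quotients be
-- written before their denominators are known to be nonzero: in the
-- eigenmatrix the denominators are c₂, …, c_d, which are positive in a
-- distance-regular graph of diameter d, and in the Gaussian coefficient they
-- are bᵏ - 1 with k ≥ 1, which are nonzero unless b = ±1 (b = 1 is treated
-- separately there).
_÷₀_ : ℚ → ℚ → ℚ
p ÷₀ q with q ≟ 0ℚ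
... | yes _   = 0ℚ
... | no  q≢0 = _÷_ p q {{≢-nonZero q≢0}}

infixr 8 _^ℤ_

_^ℤ_ : ℚ → ℤ → ℚ
p ^ℤ (+ n)    = p ^ n
p ^ℤ -[1+ n ] = 1ℚ ÷₀ (p ^ suc n)

-- For a negative upper argument this is x(x-1)⋯(x-m+1)/m!; only
-- c₀ = [0](1 + α[-1]) needs that case.
binomial : ℤ → ℕ → ℤ
binomial (+ n)    m = + (n C m)
binomial -[1+ n ] m = (-1ℤ ℤ.^ m) ℤ.* + ((n ℕ.+ m) C m)

gaussian : ℚ → ℤ → ℤ → ℚ
gaussian b n -[1+ _ ] = 0ℚ
gaussian b n (+ m)    =
  if does (b ≟ 1ℚ)
  then ℤ→ℚ (binomial n m)
  else product {m} λ h →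
         (b ^ℤ (n ℤ.- + toℕ h) - 1ℚ) ÷₀ (b ^ℤ (+ m ℤ.- + toℕ h) - 1ℚ)

record Graph (n : ℕ) : Set₁ where
  field
    Adj     : Rel (Fin n) 0ℓ
    adj?    : Decidable Adj
    symm    : Symmetric Adj
    irrefl  : Irreflexive _≡_ Adj

  data Walk : ℕ → Fin n → Fin n → Set where
    stop : ∀ {x} → Walk 0 x x
    step : ∀ {x y z l} → Adj x y → Walk l y z → Walk (suc l) x z

  IsDistance : Fin n → Fin n → ℕ → Set
  IsDistance x y i = Walk i x y × (∀ {l} → Walk l x y → i ℕ.≤ l)

-- Distance-regular graphs of diameter d on n vertices.  The field
-- `isDistance` determines `dist` and makes the graph connected.  For i ≤ d
-- the values b[ i ] and c[ i ] are determined by the graph; for i > d they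
-- are unconstrained and are never used.
record DistanceRegularGraph (n d : ℕ) : Set₁ where
  field
    graph : Graph n
  open Graph graph public

  field
    dist         : Fin n → Fin n → ℕ
    isDistance   : ∀ x y → IsDistance x y (dist x y)
    dist≤d       : ∀ x y → dist x y ℕ.≤ d
    d-attained   : ∃₂ λ x y → dist x y ≡ d
    b[_] c[_]    : ℕ → ℕ
    b-count      : ∀ {i} x y → dist x y ≡ i →
      length (filter (λ z → adj? y z ×-dec (dist x z ℕ.≟ suc i)) (allFin n))
        ≡ b[ i ]
    c-count      : ∀ {i} x y → dist x y ≡ i →
      length (filter (λ z → adj? y z ×-dec (suc (dist x z) ℕ.≟ i)) (allFin n))
        ≡ c[ i ]

  bℚ cℚ aℚ : ℕ → ℚ
  bℚ i = ℕ→ℚ b[ i ]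
  cℚ i = ℕ→ℚ c[ i ]
  aℚ i = bℚ 0 - bℚ i - cℚ i

record HasClassicalParameters {n d : ℕ} (Γ : DistanceRegularGraph n d)
                              (b : ℤ) (α β : ℚ) : Set where
  open DistanceRegularGraph Γ using (bℚ; cℚ)

  [_] : ℤ → ℚ
  [ i ] = gaussian (ℤ→ℚ b) i (+ 1)

  field
    b-formula : ∀ i → i ℕ.≤ d →
      bℚ i ≡ ([ + d ] - [ + i ]) * (β - α * [ + i ])
    c-formula : ∀ i → i ℕ.≤ d →
      cℚ i ≡ [ + i ] * (1ℚ + α * [ + i ℤ.- + 1 ])

eigenvalue : (d : ℕ) (b : ℤ) (α β : ℚ) → ℕ → ℚ
eigenvalue d b α β i = [ + d ℤ.- + i ] * (β - α * [ + i ]) - [ + i ]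
  where
  [_] : ℤ → ℚ
  [ j ] = gaussian (ℤ→ℚ b) j (+ 1)

-- Rows and columns are indexed by ℕ; only the entries with i, j ≤ d belong
-- to the matrix.
eigenmatrix : ∀ {n d} → DistanceRegularGraph n d →
              (b : ℤ) (α β : ℚ) → ℕ → ℕ → ℚ
eigenmatrix {d = d} Γ b α β i = P
  where
  open DistanceRegularGraph Γ using (aℚ; bℚ; cℚ)

  θ : ℚ
  θ = eigenvalue d b α β i

  P : ℕ → ℚ
  P 0             = 1ℚ
  P 1             = θ
  P (suc (suc j)) =
    ((θ - aℚ (suc j)) * P (suc j) - bℚ j * P j) ÷₀ cℚ (suc (suc j))

{-# OPTIONS --safe #-}
-- Write [i] for the Gaussian number [i over 1] and Q j for the claimed value of
-- P_{dj}.  Since [d] - [j] = b^j [d - j], the claim is equivalent to Q 0 = 1 and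
-- Q (j+1) [j+1] = - Q j ([d] - [j]).  As θ_d = - [d], these first-order
-- relations imply the three-term recurrence that defines P_{dj} from
-- P_{d0} = 1 and P_{d1} = - [d].  The recurrence determines P_{dj} because
-- c_j ≠ 0 for 1 ≤ j ≤ d: a geodesic of length d shows that some vertices x, y
-- are at distance j, and the last vertex before y on a shortest path from x to
-- y is counted by c_j.
module Submission where

open import Defs
open import Data.Integer.Base using (ℤ; +_; 0ℤ; -1ℤ)
open import Data.Nat.Base using (ℕ; _≤_)
open import Data.Nat.Combinatorics using (_C_)
open import Data.Rational.Base using (ℚ; 1ℚ; -_; _*_)
open import Relation.Binary.PropositionalEquality.Core using (_≡_; _≢_)

import Algebra.Properties.CommutativeMonoid.Sum as Sum
import Algebra.Properties.Monoid.Mult as Mult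
open import Data.Fin.Base using (Fin; toℕ)
import Data.Fin.Properties as Fin
import Data.Integer.Base as ℤ
import Data.Integer.Properties as ℤ
open import Data.List.Base using (_∷_; length)
open import Data.List.Membership.Propositional using (_∈_)
open import Data.List.Membership.Propositional.Properties using (∈-filter⁺; ∈-allFin)
open import Data.Nat.Base as ℕ using (zero; suc; _∸_; _<_; z≤n; _≤′_; ≤′-refl; ≤′-step)
open import Data.Nat.Combinatorics using (nC1≡n; nCk+nC[k+1]≡[n+1]C[k+1])
import Data.Nat.Properties as ℕ
import Data.Nat.Solver as ℕSolver
open import Data.Product.Base using (_×_; _,_; proj₁; proj₂; ∃; ∃₂)
open import Data.Rational.Base as ℚ using (0ℚ; _+_; _-_; toℚᵘ; 1/_; ≢-nonZero)
import Data.Rational.Properties as ℚ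
open import Data.Rational.Solver using (module +-*-Solver)
import Data.Rational.Unnormalised.Base as ℚᵘ
import Data.Rational.Unnormalised.Properties as ℚᵘ
open import Function.Base using (_∘_; _$_)
open import Relation.Binary.PropositionalEquality
  using (refl; sym; trans; cong; cong₂; subst; module ≡-Reasoning)
open import Relation.Nullary using (yes; no; contradiction)
open import Relation.Nullary.Decidable using (dec-false; _×-dec_)

open ≡-Reasoning
open +-*-Solver using (solve; con; _:=_; _:+_; _:*_; _:-_; :-_)
module Product = Sum ℚ.*-1-commutativeMonoid

-- Total division, powers and finite products over ℚ.

÷₀-*-cancel : ∀ p {q} → q ≢ 0ℚ → (p ÷₀ q) * q ≡ p
÷₀-*-cancel p {q} q≢0 with q ℚ.≟ 0ℚ
... | yes q≡0 = contradiction q≡0 q≢0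
... | no  q≢0 = begin
  p * (1/ q) * q    ≡⟨ ℚ.*-assoc p (1/ q) q ⟩
  p * (1/ q * q)    ≡⟨ cong (p *_) (ℚ.*-inverseˡ q) ⟩
  p * 1ℚ            ≡⟨ ℚ.*-identityʳ p ⟩
  p                 ∎
  where instance _ = ≢-nonZero q≢0

*-÷₀-cancel : ∀ p {q} → q ≢ 0ℚ → (p * q) ÷₀ q ≡ p
*-÷₀-cancel p {q} q≢0 with q ℚ.≟ 0ℚ
... | yes q≡0 = contradiction q≡0 q≢0
... | no  q≢0 = begin
  p * q * (1/ q)    ≡⟨ ℚ.*-assoc p q (1/ q) ⟩
  p * (q * (1/ q))  ≡⟨ cong (p *_) (ℚ.*-inverseʳ q) ⟩
  p * 1ℚ            ≡⟨ ℚ.*-identityʳ p ⟩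
  p                 ∎
  where instance _ = ≢-nonZero q≢0

*-cancelʳ : ∀ {p q r} → r ≢ 0ℚ → p * r ≡ q * r → p ≡ q
*-cancelʳ {p} {q} {r} r≢0 pr≡qr = begin
  p             ≡⟨ *-÷₀-cancel p r≢0 ⟨
  p * r ÷₀ r    ≡⟨ cong (_÷₀ r) pr≡qr ⟩
  q * r ÷₀ r    ≡⟨ *-÷₀-cancel q r≢0 ⟩
  q             ∎

*-≢0 : ∀ {p q} → p ≢ 0ℚ → q ≢ 0ℚ → p * q ≢ 0ℚ
*-≢0 {p} {q} p≢0 q≢0 pq≡0 =
  p≢0 (*-cancelʳ q≢0 (trans pq≡0 (sym (ℚ.*-zeroˡ q))))

p-q≡0⇒p≡q : ∀ {p q} → p - q ≡ 0ℚ → p ≡ q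
p-q≡0⇒p≡q {p} {q} p-q≡0 = begin
  p            ≡⟨ solve 2 (λ p q → p := (p :- q) :+ q) refl p q ⟩
  p - q + q    ≡⟨ cong (_+ q) p-q≡0 ⟩
  0ℚ + q       ≡⟨ ℚ.+-identityˡ q ⟩
  q            ∎

^-homo-+ : ∀ p m n → p ^ (m ℕ.+ n) ≡ p ^ m * p ^ n
^-homo-+ = Mult.×-homo-+ ℚ.*-1-monoid

1^n≡1 : ∀ n → 1ℚ ^ n ≡ 1ℚ
1^n≡1 zero    = refl
1^n≡1 (suc n) = trans (ℚ.*-identityˡ (1ℚ ^ n)) (1^n≡1 n)

product-≢0 : ∀ {m} (f : Fin m → ℚ) → (∀ i → f i ≢ 0ℚ) → product f ≢ 0ℚ
product-≢0 {zero}  f f≢0 ()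
product-≢0 {suc m} f f≢0 =
  *-≢0 (f≢0 Fin.zero) (product-≢0 (f ∘ Fin.suc) (f≢0 ∘ Fin.suc))

product-÷₀ : ∀ {m} (f g : Fin m → ℚ) → (∀ i → g i ≢ 0ℚ) →
  product (λ i → f i ÷₀ g i) * product g ≡ product f
product-÷₀ f g g≢0 = begin
  product (λ i → f i ÷₀ g i) * product g
    ≡⟨ Product.∑-distrib-+ (λ i → f i ÷₀ g i) g ⟨
  product (λ i → f i ÷₀ g i * g i)
    ≡⟨ Product.sum-cong-≗ (λ i → ÷₀-*-cancel (f i) (g≢0 i)) ⟩
  product f ∎

-- `product` unfolds at its first factor. Splitting off the last one is what compares the numerators
-- of two consecutive Gaussian coefficients, which share their initial factors.
product-toℕ-last : ∀ (f : ℕ → ℚ) m →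
  product {suc m} (f ∘ toℕ) ≡ product {m} (f ∘ toℕ) * f m
product-toℕ-last f m = trans (Product.sum-init-last {m} (f ∘ toℕ))
  (cong₂ _*_ (Product.sum-cong-≗ {m} (λ i → cong f (Fin.toℕ-inject₁ i)))
             (cong f (Fin.toℕ-fromℕ m)))

-- Integers inside ℚ, and binomial coefficients.

ℤ→ℚ-injective : ∀ {i j} → ℤ→ℚ i ≡ ℤ→ℚ j → i ≡ j
ℤ→ℚ-injective {i} {j} eq
  with ℚ.fromℚᵘ-injective {ℚᵘ.mkℚᵘ i 0} {ℚᵘ.mkℚᵘ j 0} eq
... | ℚᵘ.*≡* i1≡j1 = ℤ.*-cancelʳ-≡ i j (+ 1) i1≡j1

-- Bridge to unnormalised fractions, where sums and products involve no reduction to lowest terms;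
-- the homomorphism laws below are checked there.
toℚᵘ-ℤ→ℚ : ∀ i → toℚᵘ (ℤ→ℚ i) ℚᵘ.≃ ℚᵘ.mkℚᵘ i 0
toℚᵘ-ℤ→ℚ i = ℚ.toℚᵘ-fromℚᵘ (ℚᵘ.mkℚᵘ i 0)

ℤ→ℚ-homo-* : ∀ i j → ℤ→ℚ (i ℤ.* j) ≡ ℤ→ℚ i * ℤ→ℚ j
ℤ→ℚ-homo-* i j = ℚ.toℚᵘ-injective $
  ℚᵘ.≃-trans (toℚᵘ-ℤ→ℚ (i ℤ.* j)) $ ℚᵘ.≃-sym $
  ℚᵘ.≃-trans (ℚ.toℚᵘ-homo-* (ℤ→ℚ i) (ℤ→ℚ j)) $
  ℚᵘ.*-cong (toℚᵘ-ℤ→ℚ i) (toℚᵘ-ℤ→ℚ j)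

ℤ→ℚ-homo-+ : ∀ i j → ℤ→ℚ (i ℤ.+ j) ≡ ℤ→ℚ i + ℤ→ℚ j
ℤ→ℚ-homo-+ i j = ℚ.toℚᵘ-injective $
  ℚᵘ.≃-trans (toℚᵘ-ℤ→ℚ (i ℤ.+ j)) $ ℚᵘ.≃-sym $
  ℚᵘ.≃-trans (ℚ.toℚᵘ-homo-+ (ℤ→ℚ i) (ℤ→ℚ j)) $
  ℚᵘ.≃-trans (ℚᵘ.+-cong (toℚᵘ-ℤ→ℚ i) (toℚᵘ-ℤ→ℚ j)) $
  ℚᵘ.*≡* (cong (ℤ._* + 1) (cong₂ ℤ._+_ (ℤ.*-identityʳ i) (ℤ.*-identityʳ j)))

ℤ→ℚ-homo-^ : ∀ i n → ℤ→ℚ (i ℤ.^ n) ≡ ℤ→ℚ i ^ n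
ℤ→ℚ-homo-^ i zero    = refl
ℤ→ℚ-homo-^ i (suc n) =
  trans (ℤ→ℚ-homo-* i (i ℤ.^ n)) (cong (ℤ→ℚ i *_) (ℤ→ℚ-homo-^ i n))

ℕ→ℚ-homo-+ : ∀ m n → ℕ→ℚ (m ℕ.+ n) ≡ ℕ→ℚ m + ℕ→ℚ n
ℕ→ℚ-homo-+ m n = ℤ→ℚ-homo-+ (+ m) (+ n)

ℕ→ℚ-homo-* : ∀ m n → ℕ→ℚ (m ℕ.* n) ≡ ℕ→ℚ m * ℕ→ℚ n
ℕ→ℚ-homo-* m n = trans (cong ℤ→ℚ (ℤ.pos-* m n)) (ℤ→ℚ-homo-* (+ m) (+ n))

-- If the power were 1, then already over ℤ the absolute values of `b` and `b ^ k` would multiply to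
-- 1. This forces |b| = 1, and both signs are excluded.
^≢1 : ∀ {b} → b ≢ + 1 → b ≢ -1ℤ → ∀ k → ℤ→ℚ b ^ suc k ≢ 1ℚ
^≢1 {b} b≢1 b≢-1 k Bᵏ≡1 with ℤ.+∣i∣≡i⊎+∣i∣≡-i b | ∣b∣≡1
  where
  ∣b∣≡1 : ℤ.∣ b ∣ ≡ 1
  ∣b∣≡1 = ℕ.m*n≡1⇒m≡1 ℤ.∣ b ∣ ℤ.∣ b ℤ.^ k ∣ (trans (sym (ℤ.abs-* b (b ℤ.^ k)))
    (cong ℤ.∣_∣ (ℤ→ℚ-injective {b ℤ.^ suc k} {+ 1}
      (trans (ℤ→ℚ-homo-^ b (suc k)) Bᵏ≡1))))
^≢1 {+ _}        b≢1 b≢-1 k Bᵏ≡1 | _ | refl = b≢1 refl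
^≢1 { ℤ.-[1+ _ ]} b≢1 b≢-1 k Bᵏ≡1 | _ | refl = b≢-1 refl

-- This is the ratio of consecutive binomial coefficients with the subtraction in n - k moved to the
-- left, so that it holds in ℕ even for k > n.
C-absorption : ∀ n k → (n C suc k) ℕ.* suc k ℕ.+ (n C k) ℕ.* k ≡ (n C k) ℕ.* n
C-absorption zero    zero    = refl
C-absorption zero    (suc k) = refl
C-absorption (suc n) zero    = begin
  (suc n C 1) ℕ.* 1 ℕ.+ 0  ≡⟨ ℕ.+-identityʳ _ ⟩
  (suc n C 1) ℕ.* 1        ≡⟨ ℕ.*-identityʳ _ ⟩
  suc n C 1                ≡⟨ nC1≡n (suc n) ⟩
  suc n                    ≡⟨ ℕ.*-identityˡ (suc n) ⟨
  1 ℕ.* suc n              ∎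
C-absorption (suc n) (suc k) = begin
  (suc n C suc (suc k)) ℕ.* suc (suc k) ℕ.+ (suc n C suc k) ℕ.* suc k
    ≡⟨ cong₂ (λ u v → u ℕ.* suc (suc k) ℕ.+ v ℕ.* suc k)
         (sym (nCk+nC[k+1]≡[n+1]C[k+1] n (suc k)))
         (sym (nCk+nC[k+1]≡[n+1]C[k+1] n k)) ⟩
  -- After Pascal's rule the terms regroup into the left sides of the induction hypotheses at
  -- `suc k` and `k`, with x + y left over.
  (y ℕ.+ z) ℕ.* suc (suc k) ℕ.+ (x ℕ.+ y) ℕ.* suc k
    ≡⟨ N.solve 4 (λ x y z k →
         (y N.:+ z) N.:* (N.con 2 N.:+ k) N.:+ (x N.:+ y) N.:* (N.con 1 N.:+ k)
         N.:=
         (z N.:* (N.con 2 N.:+ k) N.:+ y N.:* (N.con 1 N.:+ k))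
           N.:+ (y N.:* (N.con 1 N.:+ k) N.:+ x N.:* k) N.:+ (x N.:+ y))
         refl x y z k ⟩
  (z ℕ.* suc (suc k) ℕ.+ y ℕ.* suc k) ℕ.+ (y ℕ.* suc k ℕ.+ x ℕ.* k) ℕ.+ (x ℕ.+ y)
    ≡⟨ cong₂ (λ u v → u ℕ.+ v ℕ.+ (x ℕ.+ y))
         (C-absorption n (suc k)) (C-absorption n k) ⟩
  y ℕ.* n ℕ.+ x ℕ.* n ℕ.+ (x ℕ.+ y)
    ≡⟨ N.solve 3 (λ x y n →
         y N.:* n N.:+ x N.:* n N.:+ (x N.:+ y)
         N.:= (x N.:+ y) N.:* (N.con 1 N.:+ n)) refl x y n ⟩
  (x ℕ.+ y) ℕ.* suc n
    ≡⟨ cong (ℕ._* suc n) (nCk+nC[k+1]≡[n+1]C[k+1] n k) ⟩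
  (suc n C suc k) ℕ.* suc n ∎
  where
  module N = ℕSolver.+-*-Solver
  x y z : ℕ
  x = n C k
  y = n C suc k
  z = n C suc (suc k)

[1+n]C2≡n+nC2 : ∀ n → suc n C 2 ≡ n ℕ.+ n C 2
[1+n]C2≡n+nC2 n = trans (sym (nCk+nC[k+1]≡[n+1]C[k+1] n 1))
                        (cong (ℕ._+ n C 2) (nC1≡n n))

-- Gaussian coefficients and their first-order relation.

gaussian-≢1 : ∀ {b} → b ≢ 1ℚ → ∀ n m → gaussian b n (+ m) ≡
  product {m} λ h → (b ^ℤ (n ℤ.- + toℕ h) - 1ℚ) ÷₀ (b ^ℤ (+ m ℤ.- + toℕ h) - 1ℚ)
gaussian-≢1 {b} b≢1 n m rewrite dec-false (b ℚ.≟ 1ℚ) b≢1 = refl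

^ℤ-∸ : ∀ p {m n} → n ≤ m → p ^ℤ (+ m ℤ.- + n) ≡ p ^ (m ∸ n)
^ℤ-∸ p {m} {n} n≤m = cong (p ^ℤ_) (trans (ℤ.m-n≡m⊖n m n) (ℤ.⊖-≥ n≤m))

module _ {b : ℚ} (b≢1 : b ≢ 1ℚ) (bᵏ≢1 : ∀ k → b ^ suc k ≢ 1ℚ) where

  private
    e : ℕ → ℚ
    e k = b ^ k - 1ℚ

    e≢0 : ∀ {k} → 0 < k → e k ≢ 0ℚ
    e≢0 {suc k} _ = bᵏ≢1 k ∘ p-q≡0⇒p≡q

    denominator≢0 : ∀ m → product {m} (λ h → e (m ∸ toℕ h)) ≢ 0ℚ
    denominator≢0 m = product-≢0 {m} _ (λ h → e≢0 (ℕ.m<n⇒0<n∸m (Fin.toℕ<n h)))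

  -- Each index satisfies h < m ≤ d, so all integer exponents are natural numbers and every
  -- denominator is nonzero; the product of quotients can then be cleared.
  gaussian-*-denominator : ∀ {d} m → m ≤ d →
    gaussian b (+ d) (+ m) * product {m} (λ h → e (m ∸ toℕ h))
      ≡ product {m} (λ h → e (d ∸ toℕ h))
  gaussian-*-denominator {d} m m≤d = begin
    gaussian b (+ d) (+ m) * product {m} (λ h → e (m ∸ toℕ h))
      ≡⟨ cong (_* product {m} (λ h → e (m ∸ toℕ h))) (trans (gaussian-≢1 b≢1 (+ d) m)
           (Product.sum-cong-≗ {m} λ h → cong₂ (λ u v → (u - 1ℚ) ÷₀ (v - 1ℚ))
             (^ℤ-∸ b (ℕ.≤-trans (Fin.toℕ≤n h) m≤d)) (^ℤ-∸ b (Fin.toℕ≤n h)))) ⟩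
    product {m} (λ h → e (d ∸ toℕ h) ÷₀ e (m ∸ toℕ h)) * product {m} (λ h → e (m ∸ toℕ h))
      ≡⟨ product-÷₀ {m} _ _ (λ h → e≢0 (ℕ.m<n⇒0<n∸m (Fin.toℕ<n h))) ⟩
    product {m} (λ h → e (d ∸ toℕ h)) ∎

  gaussian-ratio : ∀ {d} j → j < d →
    gaussian b (+ d) (+ suc j) * (b ^ suc j - 1ℚ)
      ≡ gaussian b (+ d) (+ j) * (b ^ (d ∸ j) - 1ℚ)
  gaussian-ratio {d} j j<d = *-cancelʳ (denominator≢0 j) (begin
    G (suc j) * e (suc j) * D j          ≡⟨ ℚ.*-assoc (G (suc j)) _ (D j) ⟩
    -- `D (suc j)` unfolds to `e (suc j) * D j`: the denominator gains its new factor in front,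
    -- whereas the numerator gains `e (d ∸ j)` at the end.
    G (suc j) * D (suc j)                ≡⟨ gaussian-*-denominator (suc j) j<d ⟩
    product {suc j} (λ h → e (d ∸ toℕ h)) ≡⟨ product-toℕ-last (λ h → e (d ∸ h)) j ⟩
    product {j} (λ h → e (d ∸ toℕ h)) * e (d ∸ j)
      ≡⟨ cong (_* e (d ∸ j)) (gaussian-*-denominator j (ℕ.<⇒≤ j<d)) ⟨
    G j * D j * e (d ∸ j)
      ≡⟨ solve 3 (λ g q r → g :* q :* r := g :* r :* q) refl (G j) (D j) (e (d ∸ j)) ⟩
    G j * e (d ∸ j) * D j                ∎)
    where
    G D : ℕ → ℚ
    G m = gaussian b (+ d) (+ m)
    D m = product {m} (λ h → e (m ∸ toℕ h))

  gaussian-number : ∀ i → gaussian b (+ i) (+ 1) * (b - 1ℚ) ≡ b ^ i - 1ℚ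
  gaussian-number i = begin
    gaussian b (+ i) (+ 1) * (b - 1ℚ)
      ≡⟨ cong (_* (b - 1ℚ)) (gaussian-≢1 b≢1 (+ i) 1) ⟩
    (b ^ (i ℕ.+ 0) - 1ℚ) ÷₀ (b * 1ℚ - 1ℚ) * 1ℚ * (b - 1ℚ)
      ≡⟨ cong₂ (λ k q → (b ^ k - 1ℚ) ÷₀ (q - 1ℚ) * 1ℚ * (b - 1ℚ))
           (ℕ.+-identityʳ i) (ℚ.*-identityʳ b) ⟩
    (b ^ i - 1ℚ) ÷₀ (b - 1ℚ) * 1ℚ * (b - 1ℚ)
      ≡⟨ cong (_* (b - 1ℚ)) (ℚ.*-identityʳ ((b ^ i - 1ℚ) ÷₀ (b - 1ℚ))) ⟩
    (b ^ i - 1ℚ) ÷₀ (b - 1ℚ) * (b - 1ℚ)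
      ≡⟨ ÷₀-*-cancel _ (b≢1 ∘ p-q≡0⇒p≡q) ⟩
    b ^ i - 1ℚ ∎

  -- Multiplying by b - 1 turns each [i] into b^i - 1. The ratio of consecutive coefficients then
  -- reduces the claim to b^j (b^(d-j) - 1) = (b^d - 1) - (b^j - 1).
  gaussian-step-≢1 : ∀ {d} j → j < d →
    gaussian b (+ d) (+ suc j) * gaussian b (+ suc j) (+ 1) * b ^ j
      ≡ gaussian b (+ d) (+ j) * (gaussian b (+ d) (+ 1) - gaussian b (+ j) (+ 1))
  gaussian-step-≢1 {d} j j<d = *-cancelʳ (b≢1 ∘ p-q≡0⇒p≡q) (begin
    G′ * [ suc j ] * b ^ j * (b - 1ℚ)
      ≡⟨ solve 4 (λ g q x y → g :* q :* x :* y := g :* (q :* y) :* x) refl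
           G′ [ suc j ] (b ^ j) (b - 1ℚ) ⟩
    G′ * ([ suc j ] * (b - 1ℚ)) * b ^ j
      ≡⟨ cong (λ u → G′ * u * b ^ j) (gaussian-number (suc j)) ⟩
    G′ * (b ^ suc j - 1ℚ) * b ^ j
      ≡⟨ cong (_* b ^ j) (gaussian-ratio j j<d) ⟩
    G * (b ^ (d ∸ j) - 1ℚ) * b ^ j
      ≡⟨ solve 3 (λ g x y → g :* (y :- con 1ℚ) :* x
                   := g :* ((x :* y :- con 1ℚ) :- (x :- con 1ℚ)))
           refl G (b ^ j) (b ^ (d ∸ j)) ⟩
    G * ((b ^ j * b ^ (d ∸ j) - 1ℚ) - (b ^ j - 1ℚ))
      ≡⟨ cong (λ u → G * ((u - 1ℚ) - (b ^ j - 1ℚ))) (trans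
           (sym (^-homo-+ b j (d ∸ j)))
           (cong (b ^_) (ℕ.m+[n∸m]≡n (ℕ.<⇒≤ j<d)))) ⟩
    G * ((b ^ d - 1ℚ) - (b ^ j - 1ℚ))
      ≡⟨ cong₂ (λ u v → G * (u - v)) (gaussian-number d) (gaussian-number j) ⟨
    G * ([ d ] * (b - 1ℚ) - [ j ] * (b - 1ℚ))
      ≡⟨ solve 4 (λ g p q r → g :* (p :* r :- q :* r) := g :* (p :- q) :* r) refl
           G [ d ] [ j ] (b - 1ℚ) ⟩
    G * ([ d ] - [ j ]) * (b - 1ℚ) ∎)
    where
    G G′ : ℚ
    G  = gaussian b (+ d) (+ j)
    G′ = gaussian b (+ d) (+ suc j)
    [_] : ℕ → ℚ
    [ i ] = gaussian b (+ i) (+ 1)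

gaussian-step-1 : ∀ d j →
  gaussian 1ℚ (+ d) (+ suc j) * gaussian 1ℚ (+ suc j) (+ 1) * 1ℚ ^ j
    ≡ gaussian 1ℚ (+ d) (+ j) * (gaussian 1ℚ (+ d) (+ 1) - gaussian 1ℚ (+ j) (+ 1))
gaussian-step-1 d j = begin
  gaussian 1ℚ (+ d) (+ suc j) * gaussian 1ℚ (+ suc j) (+ 1) * 1ℚ ^ j
    ≡⟨ cong₂ _*_ (cong (λ u → ℕ→ℚ (d C suc j) * ℕ→ℚ u) (nC1≡n (suc j))) (1^n≡1 j) ⟩
  x * ℕ→ℚ (suc j) * 1ℚ
    -- Adding and subtracting `y * ℕ→ℚ j` produces the left side of the absorption identity.
    ≡⟨ solve 3 (λ p q r → p :* con 1ℚ := (p :+ q :* r) :- q :* r) refl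
         (x * ℕ→ℚ (suc j)) y (ℕ→ℚ j) ⟩
  (x * ℕ→ℚ (suc j) + y * ℕ→ℚ j) - y * ℕ→ℚ j
    ≡⟨ cong (_- y * ℕ→ℚ j) absorption ⟩
  y * ℕ→ℚ d - y * ℕ→ℚ j
    ≡⟨ solve 3 (λ y p q → y :* p :- y :* q := y :* (p :- q)) refl y (ℕ→ℚ d) (ℕ→ℚ j) ⟩
  y * (ℕ→ℚ d - ℕ→ℚ j)
    ≡⟨ cong₂ (λ u v → y * (ℕ→ℚ u - ℕ→ℚ v)) (nC1≡n d) (nC1≡n j) ⟨
  y * (ℕ→ℚ (d C 1) - ℕ→ℚ (j C 1)) ∎
  where
  x y : ℚ
  x = ℕ→ℚ (d C suc j)
  y = ℕ→ℚ (d C j)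
  absorption : x * ℕ→ℚ (suc j) + y * ℕ→ℚ j ≡ y * ℕ→ℚ d
  absorption = begin
    x * ℕ→ℚ (suc j) + y * ℕ→ℚ j
      ≡⟨ cong₂ _+_ (ℕ→ℚ-homo-* (d C suc j) (suc j)) (ℕ→ℚ-homo-* (d C j) j) ⟨
    ℕ→ℚ ((d C suc j) ℕ.* suc j) + ℕ→ℚ ((d C j) ℕ.* j)
      ≡⟨ ℕ→ℚ-homo-+ ((d C suc j) ℕ.* suc j) ((d C j) ℕ.* j) ⟨
    ℕ→ℚ ((d C suc j) ℕ.* suc j ℕ.+ (d C j) ℕ.* j)
      ≡⟨ cong ℕ→ℚ (C-absorption d j) ⟩
    ℕ→ℚ ((d C j) ℕ.* d)
      ≡⟨ ℕ→ℚ-homo-* (d C j) d ⟩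
    y * ℕ→ℚ d ∎

-- The relation between Q j and Q (j+1) with signs and the common power of b removed. The cases
-- follow the two branches of `gaussian`; away from b = 1, excluding -1 keeps the denominators
-- nonzero.
gaussian-step : ∀ {b} → b ≢ -1ℤ → ∀ {d} j → j < d → let B = ℤ→ℚ b in
  gaussian B (+ d) (+ suc j) * gaussian B (+ suc j) (+ 1) * B ^ j
    ≡ gaussian B (+ d) (+ j) * (gaussian B (+ d) (+ 1) - gaussian B (+ j) (+ 1))
gaussian-step {b} b≢-1 {d} j j<d with b ℤ.≟ + 1
... | yes refl = gaussian-step-1 d j
... | no  b≢1  = gaussian-step-≢1 (b≢1 ∘ ℤ→ℚ-injective) (^≢1 b≢1 b≢-1) j j<d

gaussian-number-0 : ∀ b → gaussian b (+ 0) (+ 1) ≡ 0ℚ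
gaussian-number-0 b with b ℚ.≟ 1ℚ
... | yes _   = refl
... | no  b≢1 = trans (ℚ.*-identityʳ _) (begin
  -- The numerator b^0 - 1 has reduced to `0ℚ`.
  0ℚ ÷₀ q         ≡⟨ cong (_÷₀ q) (ℚ.*-zeroˡ q) ⟨
  0ℚ * q ÷₀ q     ≡⟨ *-÷₀-cancel 0ℚ (b≢1 ∘ trans (sym (ℚ.*-identityʳ b)) ∘ p-q≡0⇒p≡q) ⟩
  0ℚ              ∎)
  where
  q : ℚ
  q = b * 1ℚ - 1ℚ

gaussian-0 : ∀ b n → gaussian b (+ n) (+ 0) ≡ 1ℚ
gaussian-0 b n with b ℚ.≟ 1ℚ
... | yes _ = refl
... | no  _ = refl

-- Shortest walks and the nonvanishing of c_i.

module _ {n : ℕ} (Γ : Graph n) where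
  open Graph Γ

  walk-snoc : ∀ {l x y z} → Walk l x y → Adj y z → Walk (suc l) x z
  walk-snoc stop       a = step a stop
  walk-snoc (step a′ w) a = step a′ (walk-snoc w a)

  walk-unsnoc : ∀ {l x y} → Walk (suc l) x y → ∃ λ z → Walk l x z × Adj z y
  walk-unsnoc (step a stop)           = _ , stop , a
  walk-unsnoc (step a w@(step _ _)) with walk-unsnoc w
  ... | z , w′ , a′ = z , step a w′ , a′

∈⇒length≢0 : ∀ {a} {A : Set a} {x : A} {xs} → x ∈ xs → length xs ≢ 0
∈⇒length≢0 {xs = _ ∷ _} _ ()

module _ {n d : ℕ} (Γ : DistanceRegularGraph n d) where
  open DistanceRegularGraph Γ

  -- Cutting the last edge of a shortest walk bounds the distance to z above by i. Conversely, a
  -- shorter walk to z, extended by that edge, would reach y too early.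
  predecessor : ∀ {i} x y → dist x y ≡ suc i → ∃ λ z → Adj y z × dist x z ≡ i
  predecessor {i} x y dxy≡1+i
    with walk-unsnoc graph (subst (λ l → Walk l x y) dxy≡1+i (proj₁ (isDistance x y)))
  ... | z , w , a = z , symm a , ℕ.≤-antisym (proj₂ (isDistance x z) w)
    (ℕ.s≤s⁻¹ (subst (_≤ suc (dist x z)) dxy≡1+i
      (proj₂ (isDistance x y) (walk-snoc graph (proj₁ (isDistance x z)) a))))

  -- Starting from a pair at distance d, predecessors lower the distance by one at a time; `≤′` is
  -- used because its constructors peel from the upper end.
  distance-attained : ∀ {i} → i ≤′ d → ∃₂ λ x y → dist x y ≡ i
  distance-attained i≤′d = descend i≤′d d-attained
    where
    descend : ∀ {i m} → i ≤′ m → (∃₂ λ x y → dist x y ≡ m) → ∃₂ λ x y → dist x y ≡ i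
    descend ≤′-refl      p              = p
    descend (≤′-step le) (x , y , dxy≡) with predecessor x y dxy≡
    ... | z , _ , dxz≡ = descend le (x , z , dxz≡)

  cℚ≢0 : ∀ {i} → suc i ≤ d → cℚ (suc i) ≢ 0ℚ
  cℚ≢0 {i} i<d cℚ≡0 with distance-attained (ℕ.≤⇒≤′ i<d)
  ... | x , y , dxy≡ with predecessor x y dxy≡
  ... | z , a , dxz≡ = ∈⇒length≢0
    (∈-filter⁺ (λ z → adj? y z ×-dec (suc (dist x z) ℕ.≟ suc i)) (∈-allFin z)
      (a , cong suc dxz≡))
    (trans (c-count x y dxy≡) (ℤ.+-injective (ℤ→ℚ-injective cℚ≡0)))

-- The last eigenvalue and the recurrence for the claimed row.

eigenvalue-last : ∀ d b α β → eigenvalue d b α β d ≡ - gaussian (ℤ→ℚ b) (+ d) (+ 1)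
eigenvalue-last d b α β = begin
  gaussian B (+ d ℤ.- + d) (+ 1) * r - [d]
    ≡⟨ cong (λ i → gaussian B i (+ 1) * r - [d]) (ℤ.i≡j⇒i-j≡0 {+ d} refl) ⟩
  gaussian B (+ 0) (+ 1) * r - [d]
    ≡⟨ cong (λ u → u * r - [d]) (gaussian-number-0 B) ⟩
  0ℚ * r - [d]
    ≡⟨ solve 2 (λ r p → con 0ℚ :* r :- p := :- p) refl r [d] ⟩
  - [d] ∎
  where
  B [d] r : ℚ
  B = ℤ→ℚ b
  [d] = gaussian B (+ d) (+ 1)
  r = β - α * [d]

-- D, q₋, q₀, q₁, q₂ stand for [d], [0], [j], [j+1], [j+2] and P₀, P₁, P₂ for
-- three consecutive entries of the last row.
three-term : ∀ α β D q₋ q₀ q₁ q₂ P₀ P₁ P₂ {θ k b₀ b₁ c₁ c₂} →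
  q₋ ≡ 0ℚ → θ ≡ - D → k ≡ (D - q₋) * (β - α * q₋) →
  b₀ ≡ (D - q₀) * (β - α * q₀) → b₁ ≡ (D - q₁) * (β - α * q₁) →
  c₁ ≡ q₁ * (1ℚ + α * q₀) → c₂ ≡ q₂ * (1ℚ + α * q₁) →
  P₁ * q₁ ≡ - (P₀ * (D - q₀)) → P₂ * q₂ ≡ - (P₁ * (D - q₁)) →
  (θ - (k - b₁ - c₁)) * P₁ - b₀ * P₀ ≡ P₂ * c₂
three-term α β D _ q₀ q₁ q₂ P₀ P₁ P₂
  refl refl refl refl refl refl refl rel₁ rel₂ = begin
  A * P₁ - (D - q₀) * (β - α * q₀) * P₀
    -- Isolates the right side of `rel₁`, so that P₀ can be traded for a multiple of P₁.
    ≡⟨ solve 4 (λ u v w p → u :- v :* w :* p := u :+ w :* (:- (p :* v))) refl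
         (A * P₁) (D - q₀) (β - α * q₀) P₀ ⟩
  A * P₁ + (β - α * q₀) * (- (P₀ * (D - q₀)))
    ≡⟨ cong (λ u → A * P₁ + (β - α * q₀) * u) rel₁ ⟨
  A * P₁ + (β - α * q₀) * (P₁ * q₁)
    -- P₁ is now a common factor. In its coefficient all terms with β or q₀ cancel, and the rest
    -- factors as -(D - q₁)(1 + α q₁), ready for `rel₂`.
    ≡⟨ solve 6 (λ α β D q₀ q₁ p →
         (:- D :- ((D :- con 0ℚ) :* (β :- α :* con 0ℚ) :- (D :- q₁) :* (β :- α :* q₁)
           :- q₁ :* (con 1ℚ :+ α :* q₀))) :* p :+ (β :- α :* q₀) :* (p :* q₁)
         := (:- (p :* (D :- q₁))) :* (con 1ℚ :+ α :* q₁))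
         refl α β D q₀ q₁ P₁ ⟩
  - (P₁ * (D - q₁)) * (1ℚ + α * q₁)
    ≡⟨ cong (_* (1ℚ + α * q₁)) rel₂ ⟨
  P₂ * q₂ * (1ℚ + α * q₁)
    ≡⟨ ℚ.*-assoc P₂ q₂ _ ⟩
  P₂ * (q₂ * (1ℚ + α * q₁)) ∎
  where
  A : ℚ
  A = - D - ((D - 0ℚ) * (β - α * 0ℚ) - (D - q₁) * (β - α * q₁) - q₁ * (1ℚ + α * q₀))

-- The sequence called Q in the opening comment.
lastRow : ℕ → ℤ → ℕ → ℚ
lastRow d b j = (- 1ℚ) ^ j * gaussian (ℤ→ℚ b) (+ d) (+ j) * ℤ→ℚ b ^ (j C 2)

-- Passing from j to j + 1 changes the sign and, by C(j+1,2) = j + C(j,2), contributes exactly the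
-- factor b^j needed by `gaussian-step`.
lastRow-step : ∀ {b} → b ≢ -1ℤ → ∀ {d} j → j < d → let B = ℤ→ℚ b in
  lastRow d b (suc j) * gaussian B (+ suc j) (+ 1)
    ≡ - (lastRow d b j * (gaussian B (+ d) (+ 1) - gaussian B (+ j) (+ 1)))
lastRow-step {b} b≢-1 {d} j j<d = begin
  (- 1ℚ) * s * G′ * B ^ (suc j C 2) * q
    ≡⟨ cong (λ u → (- 1ℚ) * s * G′ * u * q)
         (trans (cong (B ^_) ([1+n]C2≡n+nC2 j)) (^-homo-+ B j (j C 2))) ⟩
  (- 1ℚ) * s * G′ * (B ^ j * t) * q
    ≡⟨ solve 5 (λ s g x t q → (:- con 1ℚ) :* s :* g :* (x :* t) :* q
                 := :- (s :* t :* (g :* q :* x))) refl s G′ (B ^ j) t q ⟩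
  - (s * t * (G′ * q * B ^ j))
    ≡⟨ cong (λ u → - (s * t * u)) (gaussian-step b≢-1 j j<d) ⟩
  - (s * t * (G * r))
    ≡⟨ solve 4 (λ s t g r → :- (s :* t :* (g :* r)) := :- (s :* g :* t :* r)) refl s t G r ⟩
  - (s * G * t * r) ∎
  where
  B s t q r G G′ : ℚ
  B = ℤ→ℚ b
  s = (- 1ℚ) ^ j
  t = B ^ (j C 2)
  q = gaussian B (+ suc j) (+ 1)
  r = gaussian B (+ d) (+ 1) - gaussian B (+ j) (+ 1)
  G = gaussian B (+ d) (+ j)
  G′ = gaussian B (+ d) (+ suc j)

-- Comparison of the eigenmatrix with the closed form.

module _ {n d : ℕ} (Γ : DistanceRegularGraph n d) {b : ℤ} {α β : ℚ}
         (b≢-1 : b ≢ -1ℤ) (cp : HasClassicalParameters Γ b α β) where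
  open DistanceRegularGraph Γ using (aℚ; bℚ; cℚ)
  open HasClassicalParameters cp

  lastRow-recurrence : ∀ j → suc (suc j) ≤ d →
    (eigenvalue d b α β d - aℚ (suc j)) * lastRow d b (suc j) - bℚ j * lastRow d b j
      ≡ lastRow d b (suc (suc j)) * cℚ (suc (suc j))
  lastRow-recurrence j j+2≤d = three-term
    α β [ + d ] [ + 0 ] [ + j ] [ + suc j ] [ + suc (suc j) ]
    (lastRow d b j) (lastRow d b (suc j)) (lastRow d b (suc (suc j)))
    (gaussian-number-0 (ℤ→ℚ b))
    (eigenvalue-last d b α β)
    (b-formula 0 z≤n)
    (b-formula j (ℕ.<⇒≤ j+1≤d))
    (b-formula (suc j) j+1≤d)
    (c-formula (suc j) j+1≤d)
    (c-formula (suc (suc j)) j+2≤d)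
    (lastRow-step b≢-1 j j+1≤d)
    (lastRow-step b≢-1 (suc j) j+2≤d)
    where
    j+1≤d : suc j ≤ d
    j+1≤d = ℕ.<⇒≤ j+2≤d

  eigenmatrix-0 : eigenmatrix Γ b α β d 0 ≡ lastRow d b 0
  eigenmatrix-0 rewrite gaussian-0 (ℤ→ℚ b) d = refl

  eigenmatrix-1 : eigenmatrix Γ b α β d 1 ≡ lastRow d b 1
  eigenmatrix-1 = trans (eigenvalue-last d b α β)
    (solve 1 (λ p → :- p := (:- con 1ℚ) :* con 1ℚ :* p :* con 1ℚ) refl [ + d ])

  eigenmatrix≡lastRow : ∀ j → j ≤ d → eigenmatrix Γ b α β d j ≡ lastRow d b j
  eigenmatrix≡lastRow zero          _     = eigenmatrix-0
  eigenmatrix≡lastRow (suc zero)    _     = eigenmatrix-1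
  eigenmatrix≡lastRow (suc (suc j)) j+2≤d = begin
    ((θ - aℚ (suc j)) * P (suc j) - bℚ j * P j) ÷₀ c
      ≡⟨ cong₂ (λ u v → ((θ - aℚ (suc j)) * u - bℚ j * v) ÷₀ c)
           (eigenmatrix≡lastRow (suc j) (ℕ.<⇒≤ j+2≤d))
           (eigenmatrix≡lastRow j (ℕ.≤-trans (ℕ.n≤1+n j) (ℕ.<⇒≤ j+2≤d))) ⟩
    ((θ - aℚ (suc j)) * lastRow d b (suc j) - bℚ j * lastRow d b j) ÷₀ c
      ≡⟨ cong (_÷₀ c) (lastRow-recurrence j j+2≤d) ⟩
    lastRow d b (suc (suc j)) * c ÷₀ c
      -- The bound j + 2 ≤ d makes c nonzero, so `÷₀` is genuine division and not its default value.
      ≡⟨ *-÷₀-cancel _ (cℚ≢0 Γ j+2≤d) ⟩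
    lastRow d b (suc (suc j)) ∎
    where
    P : ℕ → ℚ
    P = eigenmatrix Γ b α β d
    θ c : ℚ
    θ = eigenvalue d b α β d
    c = cℚ (suc (suc j))

proposition4p1 : ∀ {n d : ℕ} (Γ : DistanceRegularGraph n d) (b : ℤ) (α β : ℚ) →
    b ≢ 0ℤ → b ≢ -1ℤ →
    HasClassicalParameters Γ b α β →
    ∀ (j : ℕ) → j ≤ d →
    eigenmatrix Γ b α β d j
    ≡ (- 1ℚ) ^ j * gaussian (ℤ→ℚ b) (+ d) (+ j) * ℤ→ℚ b ^ (j C 2)
proposition4p1 Γ b α β _ b≢-1 cp = eigenmatrix≡lastRow Γ b≢-1 cp
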